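{- (Value Theorem) Let $G$ be a \textsc{flipping coins} position, and let $v_0$ be the value returned by the Algorithm described in the context when applied to $G$. Then $G=v_0$ as combinatorial games.
   Context: \textsc{Flipping coins}: a position is a finite string $d_1d_2\ldots d_n$ with each $d_i\in\{0,1\}$ (written left to right). Any $0$s after the last $1$ are deleted, so a position is either empty or ends in $1$. - A Left move chooses indices $i<j$ with $d_i=d_j=1$ and changes both to $0$. - A Right move chooses indices $k<\ell$ with $d_k=0$ and $d_\ell=1$, and changes $d_k$ to $1$ and $d_\ell$ to $0$. - After any move, all $0$s following the last $1$ are deleted. The game is played under normal play, and positions are regarded as short partizan games with the usual equality and order. Notation: juxtaposition denotes concatenation of strings, and $x^m$ denotes $m$ consecutive copies of the symbol $x$. Greek letters denote arbitrary, possibly empty, $0$-$1$ strings. The ordinal sum of games $G$ (base) and $H$ (exponent) is defined recursively by $G:H=\{G^{\mathcal L},\,G:H^{\mathcal L}\mid G^{\mathcal R},\,G:H^{\mathcal R}\}$, where $G^{\mathcal L}$ ranges over the Left options of $G$ and $H^{\mathcal L}$ over the Left options of $H$, and similarly for Right. A dyadic rational, such as $1/2^k$ or $-r$, stands for its canonical-form game. Algorithm. Input: a position $G$. Set $G_0=G$. 1. Set $i=0$. 2. Reductions (here $\alpha,\beta$ are strings, either possibly empty): (a) If $G_0=\alpha01^{3+j}\beta$ with $j\ge 1$, set $G_0=\alpha101^{j}\beta$. (b) If $G_0=\alpha01^{3}\beta$ and $\beta$ contains an even number of $1$s, set $G_0=\alpha10\beta$. (c) Repeat until neither (a) nor (b)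 applies, then go to Step 3. 3. If $G_i$ is $0^r1$ with $r\ge0$, or $G_i$ is $1^a0^{p_i}10^{q_i}1$ with $a\ge0$ and $p_i+q_i\ge0$, go to Step 5. Otherwise $G_i=\alpha01^a0^{p_i}10^{q_i}1$ with $p_i+q_i\ge1$, $a>0$ and some string $\alpha$; set $G_{i+1}=\alpha01^a$ and go to Step 4. 4. Set $i=i+1$ and go to Step 3. 5. If $G_i=0^r1$, set $v_i=-r$. If $G_i=1^a0^{p_i}10^{q_i}1$, set $v_i=\lfloor a/2\rfloor+\frac{1}{2^{2p_i+q_i}}$. 6. For $j$ from $i-1$ down to $0$, set $v_j=v_{j+1}:\frac{1}{2^{2p_j+q_j-1}}$ (ordinal sum). 7. Return $v_0$. -}

module Defs where

open import Data.Nat using (ℕ; zero; suc; _+_; _*_; _∸_; _/_; _≤_)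
open import Data.Fin using (Fin; splitAt)
open import Data.Bool using (Bool; true; false)
open import Data.List using (List; []; _∷_; _++_; map; length; lookup; replicate; [_])
open import Data.Sum using ([_,_]′)
open import Data.Product using (_×_; Σ; ∃; ∃-syntax)
open import Relation.Nullary using (¬_)
open import Relation.Binary.PropositionalEquality using (_≡_)
open import Relation.Binary.Construct.Closure.ReflexiveTransitive using (Star)

data Game : Set where
  mk : (m : ℕ) → (Fin m → Game) → (n : ℕ) → (Fin n → Game) → Game

_≤G_ : Game → Game → Set
mk m gl n gr ≤G mk m' hl n' hr =
  ((i : Fin m) → ¬ (mk m' hl n' hr ≤G gl i)) ×
  ((j : Fin n') → ¬ (hr j ≤G mk m gl n gr))

_≈G_ : Game → Game → Set
G ≈G H = (G ≤G H) × (H ≤G G)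

fromList : (l : List Game) → Fin (length l) → Game
fromList l i = lookup l i

⟪_∣_⟫ : List Game → List Game → Game
⟪ L ∣ R ⟫ = mk (length L) (fromList L) (length R) (fromList R)

_⊕_ : {m n : ℕ} → (Fin m → Game) → (Fin n → Game) → Fin (m + n) → Game
_⊕_ {m} f g i = [ f , g ]′ (splitAt m i)

_∶_ : Game → Game → Game
mk a gl b gr ∶ mk m hl n hr =
  mk (a + m) (gl ⊕ (λ i → mk a gl b gr ∶ hl i))
     (b + n) (gr ⊕ (λ j → mk a gl b gr ∶ hr j))

natG : ℕ → Game
natG zero    = ⟪ [] ∣ [] ⟫
natG (suc n) = ⟪ [ natG n ] ∣ [] ⟫

negG : ℕ → Game
negG zero    = ⟪ [] ∣ [] ⟫
negG (suc r) = ⟪ [] ∣ [ negG r ] ⟫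

-- canonical form of  n + 1/2^e  (n ≥ 0, e ≥ 0):
--   n + 1/2^0 = n + 1 ;  n + 1/2^(e+1) = { n | n + 1/2^e }
dyadic : ℕ → ℕ → Game
dyadic n zero    = natG (suc n)
dyadic n (suc e) = ⟪ [ natG n ] ∣ [ dyadic n e ] ⟫

half^ : ℕ → Game
half^ k = dyadic 0 k

-- Flipping coins positions: lists of bits, left to right (true = 1)

Pos : Set
Pos = List Bool

trim : Pos → Pos
trim []           = []
trim (true ∷ xs)  = true ∷ trim xs
trim (false ∷ xs) with trim xs
... | []     = []
... | y ∷ ys = false ∷ y ∷ ys

IsPosition : Pos → Set
IsPosition p = trim p ≡ p

clearOne : Pos → List Pos
clearOne []           = []
clearOne (true ∷ xs)  = (false ∷ xs) ∷ map (true ∷_) (clearOne xs)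
clearOne (false ∷ xs) = map (false ∷_) (clearOne xs)

leftRaw : Pos → List Pos
leftRaw []           = []
leftRaw (true ∷ xs)  = map (false ∷_) (clearOne xs) ++ map (true ∷_) (leftRaw xs)
leftRaw (false ∷ xs) = map (false ∷_) (leftRaw xs)

rightRaw : Pos → List Pos
rightRaw []           = []
rightRaw (false ∷ xs) = map (true ∷_) (clearOne xs) ++ map (false ∷_) (rightRaw xs)
rightRaw (true ∷ xs)  = map (true ∷_) (rightRaw xs)

-- weight: sum of (index+1) over the 1s; every move strictly decreases it,
-- so it bounds the depth of the game tree (used as fuel below)
weightFrom : ℕ → Pos → ℕ
weightFrom k []           = 0
weightFrom k (true ∷ xs)  = suc k + weightFrom (suc k) xs
weightFrom k (false ∷ xs) = weightFrom (suc k) xs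

weight : Pos → ℕ
weight = weightFrom 0

gameFuel : ℕ → Pos → Game
gameFuel zero    p = ⟪ [] ∣ [] ⟫
gameFuel (suc f) p =
  ⟪ map (λ q → gameFuel f (trim q)) (leftRaw p) ∣ map (λ q → gameFuel f (trim q)) (rightRaw p) ⟫

-- the game tree of a flipping coins position (fuel exceeds the depth)
gameOf : Pos → Game
gameOf p = gameFuel (suc (weight p)) p

0s 1s : ℕ → Pos
0s k = replicate k false
1s k = replicate k true

ones : Pos → ℕ
ones []           = 0
ones (true ∷ xs)  = suc (ones xs)
ones (false ∷ xs) = ones xs

-- Step 2: one reduction step, (a) or (b), anywhere in the string;
-- the result is trimmed (trailing 0s deleted) so that it is again a position
data Reduce : Pos → Pos → Set where
  ruleA : (α β : Pos) (j : ℕ) → 1 ≤ j →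
          Reduce (α ++ false ∷ 1s (3 + j) ++ β) (trim (α ++ true ∷ false ∷ 1s j ++ β))
  ruleB : (α β : Pos) (k : ℕ) → ones β ≡ 2 * k →
          Reduce (α ++ false ∷ 1s 3 ++ β) (trim (α ++ true ∷ false ∷ β))

Irreducible : Pos → Set
Irreducible p = ∀ q → ¬ Reduce p q

-- Steps 3-7: the value computed from the (reduced) string G_i.
-- Eval G v  means: starting Step 3 at G, the algorithm assigns the value v.
data Eval : Pos → Game → Set where
  base₁ : (r : ℕ) → Eval (0s r ++ [ true ]) (negG r)
  base₂ : (a p q : ℕ) →
          Eval (1s a ++ 0s p ++ true ∷ 0s q ++ [ true ]) (dyadic (a / 2) (2 * p + q))
  step  : (α : Pos) (a p q : ℕ) (w : Game) → 1 ≤ a → 1 ≤ p + q →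
          Eval (α ++ false ∷ 1s a) w →
          Eval (α ++ false ∷ 1s a ++ 0s p ++ true ∷ 0s q ++ [ true ])
               (w ∶ half^ (2 * p + q ∸ 1))

-- The Algorithm, run on G (with any admissible order of reductions in Step 2),
-- returns v.
Returns : Pos → Game → Set
Returns G v = ∃[ G₀ ] (Star Reduce G G₀ × Irreducible G₀ × Eval G₀ v)

{-# OPTIONS --safe #-}
module Submission where

open import Defs
open import Data.Nat using (ℕ; zero; suc; _+_; _*_; _∸_; _/_; _≤_; _<_; z≤n; s≤s)
open import Data.Nat.Properties using (≤-refl; ≤-trans; +-monoʳ-≤; +-monoʳ-<; m≤n+m; n≤1+n; even≢odd; +-suc; +-identityʳ)
open import Data.Nat.DivMod using (+-distrib-/-∣ˡ)
open import Data.Nat.Divisibility using (∣-refl)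
open import Data.Fin using (Fin; splitAt; _↑ˡ_; _↑ʳ_)
open import Data.Fin.Properties using (splitAt-↑ˡ; splitAt-↑ʳ)
open import Data.Bool using (Bool; true; false; not; _∧_; if_then_else_)
open import Data.Bool.Properties using (not-injective)
open import Data.List using (List; []; _∷_; _++_; map; replicate; [_])
open import Data.List.Properties using (++-identityʳ)
open import Data.List.Membership.Propositional using (_∈_)
open import Data.List.Membership.Propositional.Properties using (∈-map⁺; ∈-map⁻; ∈-++⁺ˡ; ∈-++⁺ʳ; ∈-++⁻; ∈-lookup)
open import Data.List.Relation.Unary.Any using (here; there; index)
open import Data.List.Relation.Unary.Any.Properties using (lookup-index)
open import Data.Sum using (_⊎_; inj₁; inj₂; [_,_]′)
open import Data.Product using (_×_; ∃-syntax; _,_; proj₁; proj₂)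
open import Function using (case_of_)
open import Data.Empty using (⊥-elim)
open import Relation.Nullary using (¬_)
open import Relation.Binary.PropositionalEquality using (_≡_; _≢_; refl; sym; trans; cong; subst)
open import Relation.Binary.Construct.Closure.ReflexiveTransitive using (Star; ε; _◅_)

-- Write numbers as sign expansions, ordered lexicographically.  Then ordinal sums of canonical
-- forms are concatenations, and prepending a bit to a position transforms its value by an
-- increasing function that depends only on the bit and on the parity of the number of ones.
-- These functions assign a number to every position, reduced or not, and make the Reductions
-- identities.  Since they are increasing, that a move changes the number in the right direction
-- only has to be checked for moves involving the first bit, and this follows from the
-- inequalities between the values of 01γ and 10γ, and of 00γ and 11γ.  The options also satisfy
-- the condition of the simplicity theorem, so the position equals the number.

-- Sign expansions and their order

data Sign : Set where
  ↑ ↓ : Sign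

Signs : Set
Signs = List Sign

private
  variable
    b b′ : Bool
    x : Sign
    r s t u c : Signs
    p q α β : Pos
    X Y : Game

infix 4 _≺[_]_ _⊏[_]_ _#_ _##_ _≃_ _⟶[_]_

-- The lexicographic order with ↓ < end < ↑: strict for false, weak for true.
data _≺[_]_ : Signs → Bool → Signs → Set where
  []≼[] : [] ≺[ true ] []
  ↓≺[]  : ↓ ∷ s ≺[ b ] []
  []≺↑  : [] ≺[ b ] ↑ ∷ t
  ↓≺↑   : ↓ ∷ s ≺[ b ] ↑ ∷ t
  same  : s ≺[ b ] t → x ∷ s ≺[ b ] x ∷ t

≼-refl : s ≺[ true ] s
≼-refl {[]}    = []≼[]
≼-refl {x ∷ s} = same ≼-refl

≺-trans : s ≺[ b ] t → t ≺[ b′ ] u → s ≺[ b ∧ b′ ] u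
≺-trans []≼[]    q        = q
≺-trans ↓≺[]     []≼[]    = ↓≺[]
≺-trans ↓≺[]     []≺↑     = ↓≺↑
≺-trans []≺↑     (same q) = []≺↑
≺-trans ↓≺↑      (same q) = ↓≺↑
≺-trans (same p) ↓≺[]     = ↓≺[]
≺-trans (same p) ↓≺↑      = ↓≺↑
≺-trans (same p) (same q) = same (≺-trans p q)

≺⇒≼ : s ≺[ b ] t → s ≺[ true ] t
≺⇒≼ []≼[]    = []≼[]
≺⇒≼ ↓≺[]     = ↓≺[]
≺⇒≼ []≺↑     = []≺↑
≺⇒≼ ↓≺↑      = ↓≺↑
≺⇒≼ (same p) = same (≺⇒≼ p)

s≺↑s : s ≺[ false ] ↑ ∷ s
s≺↑s {[]}    = []≺↑
s≺↑s {↑ ∷ s} = same s≺↑s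
s≺↑s {↓ ∷ s} = ↓≺↑

↓s≺s : ↓ ∷ s ≺[ false ] s
↓s≺s {[]}    = ↓≺[]
↓s≺s {↑ ∷ s} = ↓≺↑
↓s≺s {↓ ∷ s} = same ↓s≺s

++-monoʳ : ∀ r → s ≺[ b ] t → r ++ s ≺[ b ] r ++ t
++-monoʳ []      p = p
++-monoʳ (x ∷ r) p = same (++-monoʳ r p)

-- c ⊏[ x ] s: the sequence c followed by the sign x is a prefix of s.
data _⊏[_]_ : Signs → Sign → Signs → Set where
  here  : [] ⊏[ x ] x ∷ s
  there : ∀ {y} → c ⊏[ x ] s → y ∷ c ⊏[ x ] y ∷ s

⊏↑⇒≺ : c ⊏[ ↑ ] s → c ≺[ false ] s
⊏↑⇒≺ here      = []≺↑
⊏↑⇒≺ (there p) = same (⊏↑⇒≺ p)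

⊏↓⇒≻ : c ⊏[ ↓ ] s → s ≺[ false ] c
⊏↓⇒≻ here      = ↓≺[]
⊏↓⇒≻ (there p) = same (⊏↓⇒≻ p)

⊏-++ʳ : c ⊏[ x ] s → c ⊏[ x ] s ++ t
⊏-++ʳ here      = here
⊏-++ʳ (there p) = there (⊏-++ʳ p)

⊏-++ˡ : ∀ s → c ⊏[ x ] t → s ++ c ⊏[ x ] s ++ t
⊏-++ˡ []      p = p
⊏-++ˡ (y ∷ s) p = there (⊏-++ˡ s p)

⊏-++⁻ : ∀ s → c ⊏[ x ] s ++ t → (c ⊏[ x ] s) ⊎ (∃[ d ] (c ≡ s ++ d × d ⊏[ x ] t))
⊏-++⁻ []      p    = inj₂ (_ , refl , p)
⊏-++⁻ (y ∷ s) here = inj₁ here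
⊏-++⁻ (y ∷ s) (there p) with ⊏-++⁻ s p
... | inj₁ p′              = inj₁ (there p′)
... | inj₂ (d , refl , p′) = inj₂ (d , refl , p′)

-- The longest common prefix separates `s` from `t`: it is the simplest number from `s` to `t`, and
-- either `t` continues it with ↑ or `s` continues it with ↓.
≺-separate : s ≺[ false ] t →
             (∃[ c ] (s ≺[ true ] c × c ⊏[ ↑ ] t)) ⊎ (∃[ c ] (c ⊏[ ↓ ] s × c ≺[ true ] t))
≺-separate ↓≺[] = inj₂ (_ , here , []≼[])
≺-separate []≺↑ = inj₁ (_ , []≼[] , here)
≺-separate ↓≺↑  = inj₁ (_ , ↓≺[] , here)
≺-separate (same p) with ≺-separate p
... | inj₁ (c , q , q′) = inj₁ (_ , same q , there q′)
... | inj₂ (c , q , q′) = inj₂ (_ , there q , same q′)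

-- Games whose values are numbers

-- The value of the game is the number with sign expansion s, by the simplicity theorem.
data _#_ : Game → Signs → Set where
  number : ∀ {m n gl gr} →
    (∀ (i : Fin m) → ∃[ t ] (gl i # t × t ≺[ false ] s)) →
    (∀ (j : Fin n) → ∃[ t ] (gr j # t × s ≺[ false ] t)) →
    (∀ {c} → c ⊏[ ↑ ] s → ∃[ i ] ∃[ t ] (gl i # t × c ≺[ true ] t)) →
    (∀ {c} → c ⊏[ ↓ ] s → ∃[ j ] ∃[ t ] (gr j # t × t ≺[ true ] c)) →
    mk m gl n gr # s

#-≤ : ∀ X Y → X # s → Y # t → s ≺[ true ] t → X ≤G Y
#-≰ : ∀ X Y → X # s → Y # t → s ≺[ false ] t → ¬ (Y ≤G X)

#-≤ X@(mk _ gl _ _) Y@(mk _ _ _ hr) x@(number l _ _ _) y@(number _ r _ _) s≼t =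
  (λ i → let (_ , z , lt) = l i in #-≰ (gl i) Y z y (≺-trans lt s≼t)) ,
  (λ j → let (_ , z , lt) = r j in #-≰ X (hr j) x z (≺-trans s≼t lt))

#-≰ X@(mk _ _ _ gr) Y@(mk _ hl _ _) x@(number _ _ _ r) y@(number _ _ l _) s≺t (nl , nr) =
  -- `Y ≤G X` is refuted by a Left option of `Y` at or above the separating prefix, or by a Right
  -- option of `X` at or below it.
  [ (λ (_ , s≼c , c⊏t) →
       let (i , _ , z , le) = l c⊏t in nl i (#-≤ X (hl i) x z (≺-trans s≼c le))) ,
    (λ (_ , c⊏s , c≼t) →
       let (j , _ , z , le) = r c⊏s in nr j (#-≤ (gr j) Y z y (≺-trans le c≼t))) ]′
  (≺-separate s≺t)

-- Canonical forms and ordinal sums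

-- As _#_, with the additional requirement that the options are prefixes of s.  Unlike _#_,
-- this is compatible with ordinal sums, which depend on the form of the base.
data _##_ : Game → Signs → Set where
  canonical : ∀ {m n gl gr} →
    (∀ (i : Fin m) → ∃[ t ] (gl i ## t × t ⊏[ ↑ ] s)) →
    (∀ (j : Fin n) → ∃[ t ] (gr j ## t × t ⊏[ ↓ ] s)) →
    (∀ {c} → c ⊏[ ↑ ] s → ∃[ i ] ∃[ t ] (gl i ## t × c ≺[ true ] t)) →
    (∀ {c} → c ⊏[ ↓ ] s → ∃[ j ] ∃[ t ] (gr j ## t × t ≺[ true ] c)) →
    mk m gl n gr ## s

##⇒# : X ## s → X # s
##⇒# (canonical l r sl sr) = number
  (λ i → let (t , z , p) = l i in t , ##⇒# z , ⊏↑⇒≺ p)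
  (λ j → let (t , z , p) = r j in t , ##⇒# z , ⊏↓⇒≻ p)
  (λ p → let (i , t , z , q) = sl p in i , t , ##⇒# z , q)
  (λ p → let (i , t , z , q) = sr p in i , t , ##⇒# z , q)

-- A prefix followed by a sign in `s ++ t` lies inside `s` or extends `s` by such a prefix of `t`.
-- The two kinds match the options of the base and the sums of the base with options of the
-- exponent.
∶-## : X ## s → Y ## t → X ∶ Y ## s ++ t
∶-## {X = G@(mk a gl b gr)} {s = s} {Y = mk m hl n hr} {t = t}
     x@(canonical l r sl sr) (canonical l′ r′ sl′ sr′) =
  canonical left right simpleˡ simpleʳ
  where
  lefts : Fin (a + m) → Game
  lefts = gl ⊕ (λ k → G ∶ hl k)
  rights : Fin (b + n) → Game
  rights = gr ⊕ (λ k → G ∶ hr k)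
  left : ∀ i → ∃[ u ] (lefts i ## u × u ⊏[ ↑ ] s ++ t)
  left i with splitAt a i
  ... | inj₁ k = let (u , z , p) = l k in u , z , ⊏-++ʳ p
  ... | inj₂ k = let (u , z , p) = l′ k in s ++ u , ∶-## x z , ⊏-++ˡ s p
  right : ∀ j → ∃[ u ] (rights j ## u × u ⊏[ ↓ ] s ++ t)
  right j with splitAt b j
  ... | inj₁ k = let (u , z , p) = r k in u , z , ⊏-++ʳ p
  ... | inj₂ k = let (u , z , p) = r′ k in s ++ u , ∶-## x z , ⊏-++ˡ s p
  simpleˡ : ∀ {c} → c ⊏[ ↑ ] s ++ t → ∃[ i ] ∃[ u ] (lefts i ## u × c ≺[ true ] u)
  simpleˡ p with ⊏-++⁻ s p
  ... | inj₁ p′ = let (i , u , z , q) = sl p′ in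
        i ↑ˡ m , u , subst (_## u) (sym (cong [ _ , _ ]′ (splitAt-↑ˡ a i m))) z , q
  ... | inj₂ (d , refl , p′) = let (i , u , z , q) = sl′ p′ in
        a ↑ʳ i , s ++ u ,
        subst (_## (s ++ u)) (sym (cong [ _ , _ ]′ (splitAt-↑ʳ a m i))) (∶-## x z) ,
        ++-monoʳ s q
  simpleʳ : ∀ {c} → c ⊏[ ↓ ] s ++ t → ∃[ j ] ∃[ u ] (rights j ## u × u ≺[ true ] c)
  simpleʳ p with ⊏-++⁻ s p
  ... | inj₁ p′ = let (j , u , z , q) = sr p′ in
        j ↑ˡ n , u , subst (_## u) (sym (cong [ _ , _ ]′ (splitAt-↑ˡ b j n))) z , q
  ... | inj₂ (d , refl , p′) = let (j , u , z , q) = sr′ p′ in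
        b ↑ʳ j , s ++ u ,
        subst (_## (s ++ u)) (sym (cong [ _ , _ ]′ (splitAt-↑ʳ b n j))) (∶-## x z) ,
        ++-monoʳ s q

-- Integers and dyadic rationals

ups downs : ℕ → Signs
ups n   = replicate n ↑
downs n = replicate n ↓

last-↑ : ∀ n → ups n ⊏[ ↑ ] ups (suc n) ++ t
last-↑ zero    = here
last-↑ (suc n) = there (last-↑ n)

last-↓ : ∀ n → downs n ⊏[ ↓ ] downs (suc n)
last-↓ zero    = here
last-↓ (suc n) = there (last-↓ n)

below-ups : ∀ n e → c ⊏[ ↑ ] ups (suc n) ++ downs e → c ≺[ true ] ups n
below-ups zero    e       here              = []≼[]
below-ups (suc n) e       here              = []≺↑
below-ups zero    (suc e) (there (there p)) = ⊥-elim (no-↑ e p)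
  where
  no-↑ : ∀ e → ¬ (c ⊏[ ↑ ] downs e)
  no-↑ (suc e) (there p) = no-↑ e p
below-ups (suc n) e       (there p)         = same (below-ups n e p)

above-downs : ∀ e → c ⊏[ ↓ ] downs (suc e) → downs e ≺[ true ] c
above-downs zero    here      = []≼[]
above-downs (suc e) here      = ↓≺[]
above-downs (suc e) (there p) = same (above-downs e p)

above-dyadic : ∀ n e → c ⊏[ ↓ ] ups n ++ downs (suc e) → ups n ++ downs e ≺[ true ] c
above-dyadic zero    e p         = above-downs e p
above-dyadic (suc n) e (there p) = same (above-dyadic n e p)

natG-## : ∀ n → natG n ## ups n
natG-## zero    = canonical (λ ()) (λ ()) (λ ()) (λ ())
natG-## (suc n) = canonical
  (λ { Fin.zero → _ , natG-## n , subst (ups n ⊏[ ↑ ]_) (++-identityʳ (ups (suc n))) (last-↑ n) })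
  (λ ())
  (λ {c} p → Fin.zero , _ , natG-## n ,
             below-ups n 0 (subst (c ⊏[ ↑ ]_) (sym (++-identityʳ (ups (suc n)))) p))
  (λ p → ⊥-elim (no-↓ (suc n) p))
  where
  no-↓ : ∀ n → ¬ (c ⊏[ ↓ ] ups n)
  no-↓ (suc n) (there p) = no-↓ n p

negG-## : ∀ n → negG n ## downs n
negG-## zero    = canonical (λ ()) (λ ()) (λ ()) (λ ())
negG-## (suc n) = canonical
  (λ ())
  (λ { Fin.zero → _ , negG-## n , last-↓ n })
  (λ p → ⊥-elim (no-↑ (suc n) p))
  (λ p → Fin.zero , _ , negG-## n , above-downs n p)
  where
  no-↑ : ∀ n → ¬ (c ⊏[ ↑ ] downs n)
  no-↑ (suc n) (there p) = no-↑ n p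

-- After `n + 1` signs ↑, each ↓ halves the distance to `n`. So the Left option stays at `n`, and
-- the Right option drops the last ↓.
dyadic-## : ∀ n e → dyadic n e ## ups (suc n) ++ downs e
dyadic-## n zero    = subst (natG (suc n) ##_) (sym (++-identityʳ (ups (suc n)))) (natG-## (suc n))
dyadic-## n (suc e) = canonical
  (λ { Fin.zero → _ , natG-## n , last-↑ n })
  (λ { Fin.zero → _ , dyadic-## n e , ⊏-++ˡ (ups (suc n)) (last-↓ e) })
  (λ p → Fin.zero , _ , natG-## n , below-ups n (suc e) p)
  (λ p → Fin.zero , _ , dyadic-## n e , above-dyadic (suc n) e p)

-- Prepending a 0

-- zeroᵉ and zeroᵒ give the effect of prepending 0 to a position with an even, respectively odd,
-- number of ones.  On x ≥ 0, zeroᵉ is the continuous piecewise linear map f with f(x) = x/4 for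
-- x ≤ 2, f(x) = (x - 1)/2 for 2 ≤ x ≤ 3 and f(x + 3) = f(x) + 1; zeroᵒ(x) is x - 1 for x ≤ 1
-- and f(x - 1) for x ≥ 1.  The negative values of zeroᵉ are junk, chosen such that
-- zeroᵒ (↑ ∷ s) = zeroᵉ s for all s and both maps are increasing.
mutual
  zeroᵉ : Signs → Signs
  zeroᵉ []      = []
  zeroᵉ (↓ ∷ s) = ↓ ∷ ↑ ∷ s
  zeroᵉ (↑ ∷ s) = ↑ ∷ zeroᵉ↑ s

  zeroᵉ↑ : Signs → Signs
  zeroᵉ↑ []      = ↓ ∷ ↓ ∷ []
  zeroᵉ↑ (↓ ∷ s) = ↓ ∷ ↓ ∷ ↓ ∷ s
  zeroᵉ↑ (↑ ∷ s) = zeroᵉ↑↑ s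

  zeroᵉ↑↑ : Signs → Signs
  zeroᵉ↑↑ []      = ↓ ∷ []
  zeroᵉ↑↑ (↓ ∷ s) = ↓ ∷ ↓ ∷ ↑ ∷ s
  zeroᵉ↑↑ (↑ ∷ s) = zeroᵉ s

zeroᵒ : Signs → Signs
zeroᵒ []      = ↓ ∷ []
zeroᵒ (↓ ∷ s) = ↓ ∷ ↓ ∷ s
zeroᵒ (↑ ∷ s) = zeroᵉ s

↓≺zeroᵉ : ∀ s → ↓ ∷ [] ≺[ b ] zeroᵉ s
↓≺zeroᵉ []      = ↓≺[]
↓≺zeroᵉ (↓ ∷ s) = same []≺↑
↓≺zeroᵉ (↑ ∷ s) = ↓≺↑

↓↓≺zeroᵉ : ∀ s → ↓ ∷ ↓ ∷ r ≺[ b ] zeroᵉ s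
-- `true` is neutral for `_∧_`, so the result has the strictness of the second inequality.
↓↓≺zeroᵉ s = ≺-trans {b = true} (same ↓≺[]) (↓≺zeroᵉ s)

↓↓≺zeroᵉ↑↑ : ∀ s → ↓ ∷ ↓ ∷ [] ≺[ b ] zeroᵉ↑↑ s
↓↓≺zeroᵉ↑↑ []      = same ↓≺[]
↓↓≺zeroᵉ↑↑ (↓ ∷ s) = same (same []≺↑)
↓↓≺zeroᵉ↑↑ (↑ ∷ s) = ↓↓≺zeroᵉ s

zeroᵉ-mono   : s ≺[ b ] t → zeroᵉ s ≺[ b ] zeroᵉ t
zeroᵉ↑-mono  : s ≺[ b ] t → zeroᵉ↑ s ≺[ b ] zeroᵉ↑ t
zeroᵉ↑↑-mono : s ≺[ b ] t → zeroᵉ↑↑ s ≺[ b ] zeroᵉ↑↑ t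

zeroᵉ-mono []≼[]              = []≼[]
zeroᵉ-mono ↓≺[]               = ↓≺[]
zeroᵉ-mono []≺↑               = []≺↑
zeroᵉ-mono ↓≺↑                = ↓≺↑
zeroᵉ-mono {↓ ∷ _} (same p)   = same (same p)
zeroᵉ-mono {↑ ∷ _} (same p)   = same (zeroᵉ↑-mono p)

zeroᵉ↑-mono []≼[]             = ≼-refl
zeroᵉ↑-mono ↓≺[]              = same (same ↓≺[])
zeroᵉ↑-mono {t = ↑ ∷ t} []≺↑  = ↓↓≺zeroᵉ↑↑ t
zeroᵉ↑-mono {t = ↑ ∷ t} ↓≺↑   = ≺-trans {b = true} (same (same ↓≺[])) (↓↓≺zeroᵉ↑↑ t)
zeroᵉ↑-mono {↓ ∷ _} (same p)  = same (same (same p))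
zeroᵉ↑-mono {↑ ∷ _} (same p)  = zeroᵉ↑↑-mono p

zeroᵉ↑↑-mono []≼[]            = ≼-refl
zeroᵉ↑↑-mono ↓≺[]             = same ↓≺[]
zeroᵉ↑↑-mono []≺↑             = ↓≺zeroᵉ _
zeroᵉ↑↑-mono ↓≺↑              = ↓↓≺zeroᵉ _
zeroᵉ↑↑-mono {↓ ∷ _} (same p) = same (same (same p))
zeroᵉ↑↑-mono {↑ ∷ _} (same p) = zeroᵉ-mono p

zeroᵒ-mono : s ≺[ b ] t → zeroᵒ s ≺[ b ] zeroᵒ t
zeroᵒ-mono []≼[]            = ≼-refl
zeroᵒ-mono ↓≺[]             = same ↓≺[]
zeroᵒ-mono []≺↑             = ↓≺zeroᵉ _
zeroᵒ-mono ↓≺↑              = ↓↓≺zeroᵉ _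
zeroᵒ-mono {↓ ∷ _} (same p) = same (same p)
zeroᵒ-mono {↑ ∷ _} (same p) = zeroᵉ-mono p

zeroᵒ≺zeroᵉ : ∀ s → zeroᵒ s ≺[ false ] zeroᵉ s
zeroᵒ≺zeroᵉ []      = ↓≺[]
zeroᵒ≺zeroᵉ (↓ ∷ s) = same ↓≺↑
zeroᵒ≺zeroᵉ (↑ ∷ s) = zeroᵉ-mono s≺↑s

zeroᵉ≺↑ : ∀ s → zeroᵉ s ≺[ false ] ↑ ∷ s
zeroᵉ≺↑ []              = []≺↑
zeroᵉ≺↑ (↓ ∷ s)         = ↓≺↑
zeroᵉ≺↑ (↑ ∷ [])        = same ↓≺↑
zeroᵉ≺↑ (↑ ∷ ↓ ∷ s)     = same ↓≺↑
zeroᵉ≺↑ (↑ ∷ ↑ ∷ [])    = same ↓≺↑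
zeroᵉ≺↑ (↑ ∷ ↑ ∷ ↓ ∷ s) = same ↓≺↑
zeroᵉ≺↑ (↑ ∷ ↑ ∷ ↑ ∷ s) = same (≺-trans (zeroᵉ≺↑ s) (same (≺-trans s≺↑s s≺↑s)))

zeroᵒ≺ : ∀ s → zeroᵒ s ≺[ false ] s
zeroᵒ≺ []      = ↓≺[]
zeroᵒ≺ (↓ ∷ s) = same ↓s≺s
zeroᵒ≺ (↑ ∷ s) = zeroᵉ≺↑ s

zeroᵉ↑≺zeroᵒ : ∀ s → zeroᵉ↑ s ≺[ false ] zeroᵒ s
zeroᵉ↑≺zeroᵒ []          = same ↓≺[]
zeroᵉ↑≺zeroᵒ (↓ ∷ s)     = same (same ↓s≺s)
zeroᵉ↑≺zeroᵒ (↑ ∷ [])    = ↓≺[]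
zeroᵉ↑≺zeroᵒ (↑ ∷ ↓ ∷ s) = same ↓≺↑
zeroᵉ↑≺zeroᵒ (↑ ∷ ↑ ∷ s) = zeroᵉ-mono s≺↑s

zeroᵒ≼zeroᵉ↑↑ : ∀ s → zeroᵒ s ≺[ true ] zeroᵉ↑↑ s
zeroᵒ≼zeroᵉ↑↑ []      = ≼-refl
zeroᵒ≼zeroᵉ↑↑ (↓ ∷ s) = same (same (≺⇒≼ s≺↑s))
zeroᵒ≼zeroᵉ↑↑ (↑ ∷ s) = ≼-refl

zeroᵉ↑↑≺↑zeroᵒ : ∀ s → zeroᵉ↑↑ s ≺[ false ] ↑ ∷ zeroᵒ s
zeroᵉ↑↑≺↑zeroᵒ []      = ↓≺↑
zeroᵉ↑↑≺↑zeroᵒ (↓ ∷ s) = ↓≺↑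
zeroᵉ↑↑≺↑zeroᵒ (↑ ∷ s) = s≺↑s

-- Values of positions

zeroAt oneAt : Bool → Signs → Signs
zeroAt false = zeroᵉ
zeroAt true  = zeroᵒ
oneAt false s = ↑ ∷ s
oneAt true  s = s

-- val b p is the sign expansion of the value of p when b tells whether the number of ones
-- in p is odd; for the other b it is a junk value that still respects all comparisons below.
val : Bool → Pos → Signs
val b []          = []
val b (false ∷ p) = zeroAt b (val b p)
val b (true ∷ p)  = oneAt b (val (not b) p)

zeroAt-mono : ∀ b → s ≺[ b′ ] t → zeroAt b s ≺[ b′ ] zeroAt b t
zeroAt-mono false = zeroᵉ-mono
zeroAt-mono true  = zeroᵒ-mono

oneAt-mono : ∀ b → s ≺[ b′ ] t → oneAt b s ≺[ b′ ] oneAt b t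
oneAt-mono false = same
oneAt-mono true  = λ p → p

val-01≺10 : ∀ b p → val b (false ∷ true ∷ p) ≺[ false ] val b (true ∷ false ∷ p)
val-01≺10 false p = same (zeroᵉ↑≺zeroᵒ (val true p))
val-01≺10 true  p = zeroᵒ≺zeroᵉ (val false p)

val-00≺11 : ∀ b p → val b (false ∷ false ∷ p) ≺[ false ] val b (true ∷ true ∷ p)
val-00≺11 false p with val false p
... | s = ≺-trans (zeroᵉ-mono (zeroᵉ≺↑ s)) (same (≺-trans (zeroᵉ↑≺zeroᵒ s) (zeroᵒ≺ s)))
val-00≺11 true p with val true p
... | s = ≺-trans (zeroᵒ≺ (zeroᵒ s)) (≺-trans (zeroᵒ≺ s) s≺↑s)

-- Moves and the order of values

-- Required for both `b`, because passing a leading 1 flips `b`.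
Separated : Pos → Pos → Set
Separated p q = ∀ b → val b (false ∷ p) ≺[ false ] val b (true ∷ q)

separated-0∷ : ∀ p q → Separated p q → Separated (false ∷ p) (false ∷ q)
separated-0∷ p q sep b = ≺-trans (zeroAt-mono b (sep b)) (val-01≺10 b q)

separated-1∷ : ∀ p q → Separated p q → Separated (true ∷ p) (true ∷ q)
separated-1∷ p q sep b = ≺-trans (val-01≺10 b p) (oneAt-mono b (sep (not b)))

-- The first component serves Right moves on a leading 0, the second Left moves on a leading 1. The
-- induction exchanges the compared bit with the common bit after it: 00p < 01q < 10q and 01p < 10p
-- < 11q.
clearOne-separated : ∀ p → q ∈ clearOne p → Separated p q × Separated q p
clearOne-separated (false ∷ p) q∈ with ∈-map⁻ _ q∈
... | q , q∈′ , refl =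
      let (l , r) = clearOne-separated p q∈′ in separated-0∷ p q l , separated-0∷ q p r
clearOne-separated (true ∷ p) (here refl) = (λ b → val-01≺10 b p) , (λ b → val-00≺11 b p)
clearOne-separated (true ∷ p) (there q∈) with ∈-map⁻ _ q∈
... | q , q∈′ , refl =
      let (l , r) = clearOne-separated p q∈′ in separated-1∷ p q l , separated-1∷ q p r

left-decreases : ∀ b p → q ∈ leftRaw p → val b q ≺[ false ] val b p
left-decreases b (false ∷ p) q∈ with ∈-map⁻ _ q∈
... | q , q∈′ , refl = zeroAt-mono b (left-decreases b p q∈′)
left-decreases b (true ∷ p) q∈ with ∈-++⁻ (map (false ∷_) (clearOne p)) q∈
... | inj₁ q∈ˡ with ∈-map⁻ _ q∈ˡ
...   | q , q∈′ , refl = proj₂ (clearOne-separated p q∈′) b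
left-decreases b (true ∷ p) q∈ | inj₂ q∈ʳ with ∈-map⁻ _ q∈ʳ
...   | q , q∈′ , refl = oneAt-mono b (left-decreases (not b) p q∈′)

right-increases : ∀ b p → q ∈ rightRaw p → val b p ≺[ false ] val b q
right-increases b (true ∷ p) q∈ with ∈-map⁻ _ q∈
... | q , q∈′ , refl = oneAt-mono b (right-increases (not b) p q∈′)
right-increases b (false ∷ p) q∈ with ∈-++⁻ (map (true ∷_) (clearOne p)) q∈
... | inj₁ q∈ˡ with ∈-map⁻ _ q∈ˡ
...   | q , q∈′ , refl = proj₁ (clearOne-separated p q∈′) b
right-increases b (false ∷ p) q∈ | inj₂ q∈ʳ with ∈-map⁻ _ q∈ʳ
...   | q , q∈′ , refl = zeroAt-mono b (right-increases b p q∈′)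

-- Parity of the number of ones

-- The index changes along the string exactly as the flag of `val` does.
data Parity : Bool → Pos → Set where
  []  : Parity false []
  0∷_ : Parity b p → Parity b (false ∷ p)
  1∷_ : Parity (not b) p → Parity b (true ∷ p)

parity : ∀ p → ∃[ b ] Parity b p
parity [] = false , []
parity (false ∷ p) with parity p
... | b , π = b , 0∷ π
parity (true ∷ p) with parity p
... | false , π = true , 1∷ π
... | true  , π = false , 1∷ π

clearOne-parity : Parity b p → q ∈ clearOne p → Parity (not b) q
clearOne-parity (0∷ π) q∈ with ∈-map⁻ _ q∈
... | q , q∈′ , refl = 0∷ clearOne-parity π q∈′
clearOne-parity (1∷ π) (here refl) = 0∷ π
clearOne-parity (1∷ π) (there q∈) with ∈-map⁻ _ q∈
... | q , q∈′ , refl = 1∷ clearOne-parity π q∈′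

clearOne-parity⁻ : Parity (not b) p → q ∈ clearOne p → Parity b q
clearOne-parity⁻ {false} = clearOne-parity
clearOne-parity⁻ {true}  = clearOne-parity

left-parity : Parity b p → q ∈ leftRaw p → Parity b q
left-parity (0∷ π) q∈ with ∈-map⁻ _ q∈
... | q , q∈′ , refl = 0∷ left-parity π q∈′
left-parity {p = true ∷ p} (1∷ π) q∈ with ∈-++⁻ (map (false ∷_) (clearOne p)) q∈
... | inj₁ q∈ˡ with ∈-map⁻ _ q∈ˡ
...   | q , q∈′ , refl = 0∷ clearOne-parity⁻ π q∈′
left-parity {p = true ∷ p} (1∷ π) q∈ | inj₂ q∈ʳ with ∈-map⁻ _ q∈ʳ
...   | q , q∈′ , refl = 1∷ left-parity π q∈′

right-parity : Parity b p → q ∈ rightRaw p → Parity b q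
right-parity (1∷ π) q∈ with ∈-map⁻ _ q∈
... | q , q∈′ , refl = 1∷ right-parity π q∈′
right-parity {p = false ∷ p} (0∷ π) q∈ with ∈-++⁻ (map (true ∷_) (clearOne p)) q∈
... | inj₁ q∈ˡ with ∈-map⁻ _ q∈ˡ
...   | q , q∈′ , refl = 1∷ clearOne-parity π q∈′
right-parity {p = false ∷ p} (0∷ π) q∈ | inj₂ q∈ʳ with ∈-map⁻ _ q∈ʳ
...   | q , q∈′ , refl = 0∷ right-parity π q∈′

-- The simplicity condition

-- `zeroᵉ` fixes 0 and is increasing, and a leading 1 puts ↑ in front. Hence `val` at an even
-- leading 0 applies `zeroᵉ` to a nonnegative number.
even-nonneg : ∀ p → [] ≺[ true ] val false p
even-nonneg []          = []≼[]
even-nonneg (false ∷ p) = zeroᵉ-mono (even-nonneg p)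
even-nonneg (true ∷ p)  = []≺↑

-- Reduces the Left condition at a leading 0 to the tail: a move there that serves `d` also serves
-- `c`, by monotonicity.
zeroᵉ-simpleˡ : ∀ s → [] ≺[ true ] s → c ⊏[ ↑ ] zeroᵉ s →
                ∃[ d ] (d ⊏[ ↑ ] s × c ≺[ true ] zeroᵉ d)
zeroᵉ-simpleˡ (↑ ∷ s) _ here = [] , here , []≼[]
zeroᵉ-simpleˡ (↑ ∷ []) _ (there (there (there ())))
zeroᵉ-simpleˡ (↑ ∷ ↓ ∷ s) _ (there (there (there (there p)))) = _ , there (there p) , ≼-refl
zeroᵉ-simpleˡ (↑ ∷ ↑ ∷ []) _ (there (there ()))
zeroᵉ-simpleˡ (↑ ∷ ↑ ∷ ↓ ∷ s) _ (there (there (there here))) = _ , there here , ≼-refl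
zeroᵉ-simpleˡ (↑ ∷ ↑ ∷ ↓ ∷ s) _ (there (there (there (there p)))) =
  _ , there (there (there p)) , ≼-refl
zeroᵉ-simpleˡ (↑ ∷ ↑ ∷ ↑ ∷ ↓ ∷ s) _ (there (there here)) = _ , there (there here) , ≼-refl
zeroᵉ-simpleˡ (↑ ∷ ↑ ∷ ↑ ∷ ↓ ∷ s) _ (there (there (there p))) =
  _ , there (there (there (there p))) , ≼-refl
zeroᵉ-simpleˡ (↑ ∷ ↑ ∷ ↑ ∷ ↑ ∷ s) _ (there p) =
  let (_ , p′ , le) = zeroᵉ-simpleˡ (↑ ∷ s) []≺↑ p in _ , there (there (there p′)) , same le

-- Where the prefixes of `s` do not suffice, the second alternative leaves a bound that `even-right`
-- meets.
zeroᵉ-simpleʳ : ∀ s → [] ≺[ true ] s → c ⊏[ ↓ ] zeroᵉ s →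
                (∃[ d ] (d ⊏[ ↓ ] s × zeroᵉ d ≺[ true ] c)) ⊎ (zeroᵉ (↑ ∷ s) ≺[ true ] c)
zeroᵉ-simpleʳ (↑ ∷ []) _ (there here)         = inj₂ (same ↓≺[])
zeroᵉ-simpleʳ (↑ ∷ []) _ (there (there here)) = inj₂ ≼-refl
zeroᵉ-simpleʳ (↑ ∷ ↓ ∷ s) _ (there here)         = inj₂ (same ↓≺[])
zeroᵉ-simpleʳ (↑ ∷ ↓ ∷ s) _ (there (there here)) = inj₂ (same (same ↓≺[]))
zeroᵉ-simpleʳ (↑ ∷ ↓ ∷ s) _ (there (there (there here))) = inj₁ (_ , there here , ≼-refl)
zeroᵉ-simpleʳ (↑ ∷ ↓ ∷ s) _ (there (there (there (there p)))) =
  inj₁ (_ , there (there p) , ≼-refl)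
zeroᵉ-simpleʳ (↑ ∷ ↑ ∷ []) _ (there here) = inj₂ ≼-refl
zeroᵉ-simpleʳ (↑ ∷ ↑ ∷ ↓ ∷ s) _ (there here) = inj₁ (_ , there (there here) , same ↓≺[])
zeroᵉ-simpleʳ (↑ ∷ ↑ ∷ ↓ ∷ s) _ (there (there here)) = inj₁ (_ , there (there here) , ≼-refl)
zeroᵉ-simpleʳ (↑ ∷ ↑ ∷ ↓ ∷ s) _ (there (there (there (there p)))) =
  inj₁ (_ , there (there (there p)) , ≼-refl)
zeroᵉ-simpleʳ (↑ ∷ ↑ ∷ ↑ ∷ ↓ ∷ s) _ (there here) =
  inj₁ (_ , there (there (there here)) , ≼-refl)
zeroᵉ-simpleʳ (↑ ∷ ↑ ∷ ↑ ∷ ↓ ∷ s) _ (there (there (there p))) =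
  inj₁ (_ , there (there (there (there p))) , ≼-refl)
zeroᵉ-simpleʳ (↑ ∷ ↑ ∷ ↑ ∷ ↑ ∷ s) _ (there p) with zeroᵉ-simpleʳ (↑ ∷ s) []≺↑ p
... | inj₁ (_ , p′ , le) = inj₁ (_ , there (there (there p′)) , same le)
... | inj₂ le            = inj₂ (same le)

zeroᵒ-simpleˡ : ∀ s → c ⊏[ ↑ ] zeroᵒ s → ∃[ d ] (d ⊏[ ↑ ] s × c ≺[ true ] zeroᵒ d)
zeroᵒ-simpleˡ [] (there ())
zeroᵒ-simpleˡ (↓ ∷ s) (there (there p))     = _ , there p , ≼-refl
zeroᵒ-simpleˡ (↑ ∷ ↓ ∷ s) (there here)      = _ , here , ≼-refl
zeroᵒ-simpleˡ (↑ ∷ ↓ ∷ s) (there (there p)) = _ , there (there p) , ≼-refl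
zeroᵒ-simpleˡ (↑ ∷ ↑ ∷ s) p =
  let (_ , p′ , le) = zeroᵉ-simpleˡ (↑ ∷ s) []≺↑ p in _ , there p′ , le

zeroᵒ-simpleʳ : ∀ s → c ⊏[ ↓ ] zeroᵒ s →
                (∃[ d ] (d ⊏[ ↓ ] s × zeroᵒ d ≺[ true ] c)) ⊎ ([] ≺[ true ] s × zeroᵉ s ≺[ true ] c)
zeroᵒ-simpleʳ [] here = inj₂ ([]≼[] , []≼[])
zeroᵒ-simpleʳ (↓ ∷ s) here                  = inj₁ (_ , here , ↓≺[])
zeroᵒ-simpleʳ (↓ ∷ s) (there here)          = inj₁ (_ , here , ≼-refl)
zeroᵒ-simpleʳ (↓ ∷ s) (there (there p))     = inj₁ (_ , there p , ≼-refl)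
zeroᵒ-simpleʳ (↑ ∷ ↓ ∷ s) here              = inj₁ (_ , there here , ≼-refl)
zeroᵒ-simpleʳ (↑ ∷ ↓ ∷ s) (there (there p)) = inj₁ (_ , there (there p) , ≼-refl)
zeroᵒ-simpleʳ (↑ ∷ ↑ ∷ s) p with zeroᵉ-simpleʳ (↑ ∷ s) []≺↑ p
... | inj₁ (_ , p′ , le) = inj₁ (_ , there p′ , le)
... | inj₂ le            = inj₂ ([]≺↑ , le)

zeroᵉ↑↑≡↑zeroᵒ : [] ≺[ true ] s → zeroᵉ (↑ ∷ ↑ ∷ s) ≡ ↑ ∷ zeroᵒ s
zeroᵉ↑↑≡↑zeroᵒ []≼[] = refl
zeroᵉ↑↑≡↑zeroᵒ []≺↑  = refl

↑zeroᵒ≼zeroᵉ↑↑ : ∀ s → ↑ ∷ zeroᵒ s ≺[ true ] zeroᵉ (↑ ∷ ↑ ∷ s)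
↑zeroᵒ≼zeroᵉ↑↑ s = same (zeroᵒ≼zeroᵉ↑↑ s)

-- In both bounds the one cleared is the first in the string.
odd-clear : Parity true p →
            ∃[ q ] (q ∈ clearOne p × val false q ≺[ true ] zeroᵉ (↑ ∷ ↑ ∷ val true p))
odd-clear {true ∷ p} (1∷ π) =
  false ∷ p , here refl , zeroᵉ-mono (≺⇒≼ (≺-trans s≺↑s s≺↑s))
odd-clear {false ∷ p} (0∷ π) with odd-clear π
... | q , q∈ , le = false ∷ q , ∈-map⁺ _ q∈ ,
      ≺-trans (zeroᵉ-mono le) (≺⇒≼ (zeroᵉ-mono (same {x = ↑} (zeroᵉ↑↑≺↑zeroᵒ (val true p)))))

even-clear : Parity false p → val false p ≢ [] →
             ∃[ q ] (q ∈ clearOne p × val true q ≺[ true ] zeroᵉ (val false p))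
even-clear [] ne = ⊥-elim (ne refl)
even-clear {true ∷ p} (1∷ π) ne =
  false ∷ p , here refl , ≺⇒≼ (≺-trans (zeroᵒ≺zeroᵉ (val true p)) (zeroᵉ-mono s≺↑s))
even-clear {false ∷ p} (0∷ π) ne with even-clear π (λ eq → ne (cong zeroᵉ eq))
... | q , q∈ , le = false ∷ q , ∈-map⁺ _ q∈ ,
      ≺-trans (zeroᵒ-mono le) (≺⇒≼ (zeroᵒ≺zeroᵉ _))

-- If the string starts with 01, this becomes 10. If it starts with 00, the second 0 becomes 1 and
-- the first 1 after it is cleared.
even-right : Parity false p → val false p ≢ [] →
             ∃[ q ] (q ∈ rightRaw (false ∷ p) × val false q ≺[ true ] zeroᵉ (↑ ∷ val false p))
even-right [] ne = ⊥-elim (ne refl)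
even-right {true ∷ p} (1∷ π) ne =
  true ∷ false ∷ p , here refl , ↑zeroᵒ≼zeroᵉ↑↑ (val true p)
even-right {false ∷ p} (0∷ π) ne with even-clear π (λ eq → ne (cong zeroᵉ eq))
... | q , q∈ , le = false ∷ true ∷ q ,
      ∈-++⁺ʳ (map (true ∷_) (clearOne (false ∷ p))) (∈-map⁺ _ (∈-++⁺ˡ (∈-map⁺ _ q∈))) ,
      zeroᵉ-mono (same {x = ↑} le)

odd-right : Parity true p → [] ≺[ true ] val true p →
            ∃[ q ] (q ∈ rightRaw (false ∷ p) × val true q ≺[ true ] zeroᵉ (val true p))
odd-right {true ∷ p} (1∷ π) _ = true ∷ false ∷ p , here refl , ≼-refl
odd-right {false ∷ p} (0∷ π) nonneg with odd-clear π
... | q , q∈ , le = false ∷ true ∷ q ,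
      ∈-++⁺ʳ (map (true ∷_) (clearOne (false ∷ p))) (∈-map⁺ _ (∈-++⁺ˡ (∈-map⁺ _ q∈))) ,
      ≺-trans (zeroᵒ-mono le) (bound (val true p) nonneg)
  where
  bound : ∀ s → [] ≺[ true ] zeroᵒ s → zeroᵒ (zeroᵉ (↑ ∷ ↑ ∷ s)) ≺[ true ] zeroᵉ (zeroᵒ s)
  -- Nonnegativity excludes the other forms of the argument; here both sides compute to
  -- `zeroᵉ (zeroᵉ s)`.
  bound (↑ ∷ s) _ = ≼-refl

val-simpleˡ : Parity b p → c ⊏[ ↑ ] val b p → ∃[ q ] (q ∈ leftRaw p × c ≺[ true ] val b q)
val-simpleˡ {false} {false ∷ p} (0∷ π) c⊏ with zeroᵉ-simpleˡ (val false p) (even-nonneg p) c⊏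
... | d , d⊏ , c≼ with val-simpleˡ π d⊏
...   | q , q∈ , d≼ = false ∷ q , ∈-map⁺ _ q∈ , ≺-trans c≼ (zeroᵉ-mono d≼)
val-simpleˡ {true} {false ∷ p} (0∷ π) c⊏ with zeroᵒ-simpleˡ (val true p) c⊏
... | d , d⊏ , c≼ with val-simpleˡ π d⊏
...   | q , q∈ , d≼ = false ∷ q , ∈-map⁺ _ q∈ , ≺-trans c≼ (zeroᵒ-mono d≼)
-- Here `c` is 0. The odd rest has a 1 to clear together with the first bit, and the resulting even
-- position is nonnegative.
val-simpleˡ {false} {true ∷ p} (1∷ π) here with odd-clear π
... | q , q∈ , _ = false ∷ q , ∈-++⁺ˡ (∈-map⁺ _ q∈) , even-nonneg (false ∷ q)
val-simpleˡ {false} {true ∷ p} (1∷ π) (there c⊏) with val-simpleˡ π c⊏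
... | q , q∈ , c≼ = true ∷ q , ∈-++⁺ʳ (map (false ∷_) (clearOne p)) (∈-map⁺ _ q∈) , same c≼
val-simpleˡ {true} {true ∷ p} (1∷ π) c⊏ with val-simpleˡ π c⊏
... | q , q∈ , c≼ = true ∷ q , ∈-++⁺ʳ (map (false ∷_) (clearOne p)) (∈-map⁺ _ q∈) , c≼

val-simpleʳ : Parity b p → c ⊏[ ↓ ] val b p → ∃[ q ] (q ∈ rightRaw p × val b q ≺[ true ] c)
val-simpleʳ {false} {false ∷ p} (0∷ π) c⊏ with zeroᵉ-simpleʳ (val false p) (even-nonneg p) c⊏
... | inj₁ (d , d⊏ , ≼c) with val-simpleʳ π d⊏
...   | q , q∈ , ≼d = false ∷ q , ∈-++⁺ʳ (map (true ∷_) (clearOne p)) (∈-map⁺ _ q∈) ,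
        ≺-trans (zeroᵉ-mono ≼d) ≼c
val-simpleʳ {false} {false ∷ p} (0∷ π) c⊏ | inj₂ ≼c
  with even-right π (λ eq → case subst (λ s → _ ⊏[ ↓ ] zeroᵉ s) eq c⊏ of λ ())
... | q , q∈ , q≼ = q , q∈ , ≺-trans q≼ ≼c
val-simpleʳ {true} {false ∷ p} (0∷ π) c⊏ with zeroᵒ-simpleʳ (val true p) c⊏
... | inj₁ (d , d⊏ , ≼c) with val-simpleʳ π d⊏
...   | q , q∈ , ≼d = false ∷ q , ∈-++⁺ʳ (map (true ∷_) (clearOne p)) (∈-map⁺ _ q∈) ,
        ≺-trans (zeroᵒ-mono ≼d) ≼c
val-simpleʳ {true} {false ∷ p} (0∷ π) c⊏ | inj₂ (nonneg , ≼c) with odd-right π nonneg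
... | q , q∈ , q≼ = q , q∈ , ≺-trans q≼ ≼c
val-simpleʳ {false} {true ∷ p} (1∷ π) (there c⊏) with val-simpleʳ π c⊏
... | q , q∈ , ≼c = true ∷ q , ∈-map⁺ _ q∈ , same ≼c
val-simpleʳ {true} {true ∷ p} (1∷ π) c⊏ with val-simpleʳ π c⊏
... | q , q∈ , ≼c = true ∷ q , ∈-map⁺ _ q∈ , ≼c

-- Moves decrease the weight

-- The cleared 1 weighs at least `suc k`; this surplus pays for the 1 that a Right move sets further
-- left.
clearOne-weight : ∀ k p → q ∈ clearOne p → suc k + weightFrom k q ≤ weightFrom k p
clearOne-weight k (false ∷ p) q∈ with ∈-map⁻ _ q∈
... | q , q∈′ , refl = ≤-trans (n≤1+n _) (clearOne-weight (suc k) p q∈′)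
clearOne-weight k (true ∷ p) (here refl) = ≤-refl
clearOne-weight k (true ∷ p) (there q∈) with ∈-map⁻ _ q∈
... | q , q∈′ , refl = +-monoʳ-≤ (suc k) (≤-trans (n≤1+n _) (clearOne-weight (suc k) p q∈′))

left-weight : ∀ k p → q ∈ leftRaw p → weightFrom k q < weightFrom k p
left-weight k (false ∷ p) q∈ with ∈-map⁻ _ q∈
... | q , q∈′ , refl = left-weight (suc k) p q∈′
left-weight k (true ∷ p) q∈ with ∈-++⁻ (map (false ∷_) (clearOne p)) q∈
... | inj₁ q∈ˡ with ∈-map⁻ _ q∈ˡ
...   | q , q∈′ , refl =
        s≤s (≤-trans (m≤n+m _ (suc (suc k))) (≤-trans (clearOne-weight (suc k) p q∈′) (m≤n+m _ k)))
left-weight k (true ∷ p) q∈ | inj₂ q∈ʳ with ∈-map⁻ _ q∈ʳ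
...   | q , q∈′ , refl = +-monoʳ-< (suc k) (left-weight (suc k) p q∈′)

right-weight : ∀ k p → q ∈ rightRaw p → weightFrom k q < weightFrom k p
right-weight k (true ∷ p) q∈ with ∈-map⁻ _ q∈
... | q , q∈′ , refl = +-monoʳ-< (suc k) (right-weight (suc k) p q∈′)
right-weight k (false ∷ p) q∈ with ∈-++⁻ (map (true ∷_) (clearOne p)) q∈
... | inj₁ q∈ˡ with ∈-map⁻ _ q∈ˡ
...   | q , q∈′ , refl = clearOne-weight (suc k) p q∈′
right-weight k (false ∷ p) q∈ | inj₂ q∈ʳ with ∈-map⁻ _ q∈ʳ
...   | q , q∈′ , refl = right-weight (suc k) p q∈′

trim-weight : ∀ k p → weightFrom k (trim p) ≡ weightFrom k p
trim-weight k []          = refl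
trim-weight k (true ∷ p)  = cong (suc k +_) (trim-weight (suc k) p)
trim-weight k (false ∷ p) with trim p | trim-weight (suc k) p
... | []    | eq = eq
... | _ ∷ _ | eq = eq

-- Positions of equal value

-- Restricted to the true parity: at the other one, trimming a trailing 0 could change the value, as
-- `zeroᵒ []` is -1.
_≃_ : Pos → Pos → Set
p ≃ q = ∀ b → Parity b p → Parity b q × val b p ≡ val b q

≃-trans : p ≃ q → q ≃ α → p ≃ α
≃-trans eq eq′ b π =
  let (π′ , e) = eq b π ; (π″ , e′) = eq′ b π′ in π″ , trans e e′

∷-≃ : ∀ y → p ≃ q → y ∷ p ≃ y ∷ q
∷-≃ false eq b (0∷ π) = let (π′ , e) = eq b π in 0∷ π′ , cong (zeroAt b) e
∷-≃ true  eq b (1∷ π) = let (π′ , e) = eq (not b) π in 1∷ π′ , cong (oneAt b) e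

++-≃ : ∀ α → p ≃ q → α ++ p ≃ α ++ q
++-≃ []      eq = eq
++-≃ (y ∷ α) eq = ∷-≃ y (++-≃ α eq)

trim-≃ : ∀ p → p ≃ trim p
trim-≃ []          b π = π , refl
trim-≃ (true ∷ p)  = ∷-≃ true (trim-≃ p)
trim-≃ (false ∷ p) with trim p | trim-≃ p
... | _ ∷ _ | eq = ∷-≃ false eq
... | []    | eq = zero-≃
  where
  zero-≃ : false ∷ p ≃ []
  zero-≃ b (0∷ π) with eq b π
  ... | [] , e = [] , cong zeroᵉ e

-- The game of a position

gameFuel-# : ∀ n p b → Parity b p → weight p < n → gameFuel n p # val b p
gameFuel-# (suc n) p b π (s≤s w≤n) = number
  (λ i → let (q , q∈ , eq) = ∈-map⁻ option (∈-lookup i) in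
     val b q , subst (_# val b q) (sym eq) (left q∈) , left-decreases b p q∈)
  (λ j → let (q , q∈ , eq) = ∈-map⁻ option (∈-lookup j) in
     val b q , subst (_# val b q) (sym eq) (right q∈) , right-increases b p q∈)
  (λ c⊏ → let (q , q∈ , c≼) = val-simpleˡ π c⊏ ; o∈ = ∈-map⁺ option q∈ in
     index o∈ , val b q , subst (_# val b q) (lookup-index o∈) (left q∈) , c≼)
  (λ c⊏ → let (q , q∈ , ≼c) = val-simpleʳ π c⊏ ; o∈ = ∈-map⁺ option q∈ in
     index o∈ , val b q , subst (_# val b q) (lookup-index o∈) (right q∈) , ≼c)
  where
  option : Pos → Game
  option q = gameFuel n (trim q)
  option-# : ∀ q → Parity b q → weight q < weight p → option q # val b q
  option-# q π′ w with trim-≃ q b π′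
  ... | π″ , e = subst (option q #_) (sym e)
        (gameFuel-# n (trim q) b π″ (subst (_< n) (sym (trim-weight 0 q)) (≤-trans w w≤n)))
  left : q ∈ leftRaw p → option q # val b q
  left q∈ = option-# _ (left-parity π q∈) (left-weight 0 p q∈)
  right : q ∈ rightRaw p → option q # val b q
  right q∈ = option-# _ (right-parity π q∈) (right-weight 0 p q∈)

-- Reductions preserve the value

-- In the even case γ is even too, so its value is nonnegative and `zeroᵉ↑↑≡↑zeroᵒ` applies. In the
-- odd case both sides compute to the same expression.
01111-≃ : ∀ γ → false ∷ 1s 4 ++ γ ≃ true ∷ false ∷ true ∷ γ
01111-≃ γ false (0∷ 1∷ 1∷ 1∷ 1∷ π) = 1∷ 0∷ 1∷ π , zeroᵉ↑↑≡↑zeroᵒ (even-nonneg γ)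
01111-≃ γ true  (0∷ 1∷ 1∷ 1∷ 1∷ π) = 1∷ 0∷ 1∷ π , refl

Parity⇒ones : Parity b p → if b then (∃[ k ] ones p ≡ suc (2 * k)) else (∃[ k ] ones p ≡ 2 * k)
Parity⇒ones [] = 0 , refl
Parity⇒ones (0∷ π) = Parity⇒ones π
Parity⇒ones {false} (1∷ π) =
  let (k , eq) = Parity⇒ones π in suc k , trans (cong suc eq) (cong suc (sym (+-suc k (k + 0))))
Parity⇒ones {true} (1∷ π) =
  let (k , eq) = Parity⇒ones π in k , cong suc eq

-- As β is even, the whole string is odd, and the claim is the equation `zeroᵒ (↑ ∷ s) = zeroᵉ s`.
0111-≃ : ∀ k → ones β ≡ 2 * k → false ∷ 1s 3 ++ β ≃ true ∷ false ∷ β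
0111-≃ k eq false (0∷ 1∷ 1∷ 1∷ π) =
  let (m , eq′) = Parity⇒ones π in ⊥-elim (even≢odd k m (trans (sym eq) eq′))
0111-≃ k eq true (0∷ 1∷ 1∷ 1∷ π) = 1∷ 0∷ π , refl

Reduce⇒≃ : Reduce p q → p ≃ q
-- Of the `suc j` ones that the rule keeps, one ends the pattern 101 and the others join γ.
Reduce⇒≃ (ruleA α β (suc j) _) = ≃-trans (++-≃ α (01111-≃ (1s j ++ β))) (trim-≃ _)
Reduce⇒≃ (ruleB α β k eq)      = ≃-trans (++-≃ α (0111-≃ k eq)) (trim-≃ _)

Reduce*⇒≃ : Star Reduce p q → p ≃ q
Reduce*⇒≃ ε        b π = π , refl
Reduce*⇒≃ (r ◅ rs) = ≃-trans (Reduce⇒≃ r) (Reduce*⇒≃ rs)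

-- Appending a block to a position

-- Every clause of `zeroᵉ` and its helpers that reads a ↓ copies what follows.
zeroᵉ-++ : ∀ s t → ↓ ∈ s → zeroᵉ (s ++ t) ≡ zeroᵉ s ++ t
zeroᵉ-++ (↓ ∷ s)         t ↓∈                 = refl
zeroᵉ-++ (↑ ∷ [])        t (there ())
zeroᵉ-++ (↑ ∷ ↓ ∷ s)     t ↓∈                 = refl
zeroᵉ-++ (↑ ∷ ↑ ∷ [])    t (there (there ()))
zeroᵉ-++ (↑ ∷ ↑ ∷ ↓ ∷ s) t ↓∈                 = refl
zeroᵉ-++ (↑ ∷ ↑ ∷ ↑ ∷ s) t (there (there (there ↓∈))) = cong (↑ ∷_) (zeroᵉ-++ s t ↓∈)

zeroᵒ-++ : ∀ s t → ↓ ∈ s → zeroᵒ (s ++ t) ≡ zeroᵒ s ++ t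
zeroᵒ-++ (↓ ∷ s)     t ↓∈         = refl
zeroᵒ-++ (↑ ∷ s)     t (there ↓∈) = zeroᵉ-++ s t ↓∈

↓∈zeroᵉ : ∀ s → ↓ ∈ s → ↓ ∈ zeroᵉ s
↓∈zeroᵉ (↓ ∷ s)         _ = here refl
↓∈zeroᵉ (↑ ∷ [])        _ = there (here refl)
↓∈zeroᵉ (↑ ∷ ↓ ∷ s)     _ = there (here refl)
↓∈zeroᵉ (↑ ∷ ↑ ∷ [])    _ = there (here refl)
↓∈zeroᵉ (↑ ∷ ↑ ∷ ↓ ∷ s) _ = there (here refl)
↓∈zeroᵉ (↑ ∷ ↑ ∷ ↑ ∷ s) (there (there (there ↓∈))) = there (↓∈zeroᵉ s ↓∈)

↓∈zeroᵒ : ∀ s → ↓ ∈ s → ↓ ∈ zeroᵒ s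
↓∈zeroᵒ (↓ ∷ s) _          = here refl
↓∈zeroᵒ (↑ ∷ s) (there ↓∈) = ↓∈zeroᵉ s ↓∈

-- Passing from p to q appends t to the value; the condition ↓ ∈ val b p makes this stable
-- under prepending bits.
_⟶[_]_ : Pos → Signs → Pos → Set
p ⟶[ t ] q = ∀ b → Parity b p → Parity b q × ↓ ∈ val b p × val b q ≡ val b p ++ t

++-⟶ : ∀ α → p ⟶[ t ] q → α ++ p ⟶[ t ] α ++ q
++-⟶ [] eq = eq
++-⟶ {p} {t} (false ∷ α) eq false (0∷ π) =
  let (π′ , ↓∈ , e) = ++-⟶ α eq false π ; s = val false (α ++ p) in
  0∷ π′ , ↓∈zeroᵉ s ↓∈ , trans (cong zeroᵉ e) (zeroᵉ-++ s t ↓∈)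
++-⟶ {p} {t} (false ∷ α) eq true (0∷ π) =
  let (π′ , ↓∈ , e) = ++-⟶ α eq true π ; s = val true (α ++ p) in
  0∷ π′ , ↓∈zeroᵒ s ↓∈ , trans (cong zeroᵒ e) (zeroᵒ-++ s t ↓∈)
++-⟶ (true ∷ α) eq false (1∷ π) =
  let (π′ , ↓∈ , e) = ++-⟶ α eq true π in 1∷ π′ , there ↓∈ , cong (↑ ∷_) e
++-⟶ (true ∷ α) eq true (1∷ π) =
  let (π′ , ↓∈ , e) = ++-⟶ α eq false π in 1∷ π′ , ↓∈ , e

zeros-one : ∀ r → Parity true (0s r ++ [ true ]) × val true (0s r ++ [ true ]) ≡ downs r
zeros-one zero    = 1∷ [] , refl
zeros-one (suc r) with zeros-one r
... | π , e = 0∷ π , trans (cong zeroᵒ e) (zeroᵒ-downs r)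
  where
  zeroᵒ-downs : ∀ r → zeroᵒ (downs r) ≡ downs (suc r)
  zeroᵒ-downs zero    = refl
  zeroᵒ-downs (suc r) = refl

block : ℕ → ℕ → Pos
block p q = 0s p ++ true ∷ 0s q ++ [ true ]

-- The part after the leading zeros and the first 1 has value -q, this 1 puts ↑ in front, and each
-- leading 0 divides by four, inserting two ↓.
block-val : ∀ p q → Parity false (block p q) × val false (block p q) ≡ ↑ ∷ downs (2 * p + q)
block-val zero q = let (π , e) = zeros-one q in 1∷ π , cong (↑ ∷_) e
block-val (suc p) q with block-val p q
... | π , e = 0∷ π ,
      trans (cong zeroᵉ e) (trans (zeroᵉ-half (2 * p + q))
        (cong (λ n → ↑ ∷ ↓ ∷ downs (n + q)) (sym (+-suc p (p + 0)))))
  where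
  zeroᵉ-half : ∀ n → zeroᵉ (↑ ∷ downs n) ≡ ↑ ∷ ↓ ∷ ↓ ∷ downs n
  zeroᵉ-half zero    = refl
  zeroᵉ-half (suc n) = refl

half-2+ : ∀ a → (2 + a) / 2 ≡ suc (a / 2)
half-2+ a = +-distrib-/-∣ˡ {2} a {2} ∣-refl

-- For either parity, two leading 1s together contribute one ↑; a single leftover 1 contributes
-- nothing.
ones-block : ∀ a p q → ∃[ b ] (Parity b (1s a ++ block p q) ×
             val b (1s a ++ block p q) ≡ ups (suc (a / 2)) ++ downs (2 * p + q))
ones-block zero          p q = false , block-val p q
ones-block (suc zero)    p q = let (π , e) = block-val p q in true , 1∷ π , e
ones-block (suc (suc a)) p q with ones-block a p q
... | false , π , e = false , 1∷ 1∷ π ,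
      trans (cong (↑ ∷_) e) (cong (λ k → ups (suc k) ++ downs (2 * p + q)) (sym (half-2+ a)))
... | true  , π , e = true , 1∷ 1∷ π ,
      trans (cong (↑ ∷_) e) (cong (λ k → ups (suc k) ++ downs (2 * p + q)) (sym (half-2+ a)))

-- The values of 01 and 011 are ↓ and ↑↓↓, so both contain a ↓. The appended signs are the expansion
-- of `half^ n`, the exponent in `step`.
block-appends : ∀ a p q n → 1 ≤ a → a ≤ 2 → 2 * p + q ≡ suc n →
                false ∷ 1s a ⟶[ ↑ ∷ downs n ] false ∷ 1s a ++ block p q
block-appends 1 p q n _ _ eq true (0∷ 1∷ []) with block-val p q
... | π , e rewrite e | eq = 0∷ 1∷ π , here refl , refl
block-appends 2 p q n _ _ eq false (0∷ 1∷ 1∷ []) with block-val p q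
... | π , e rewrite e | eq = 0∷ 1∷ 1∷ π , there (here refl) , refl
block-appends (suc (suc (suc _))) p q n _ (s≤s (s≤s ()))

-- Trailing ones of evaluated strings

trailingOnes : ℕ → Pos → ℕ
trailingOnes n []          = n
trailingOnes n (true ∷ p)  = trailingOnes (suc n) p
trailingOnes n (false ∷ p) = trailingOnes 0 p

trailingOnes-1s : ∀ n a → trailingOnes n (1s a) ≡ a + n
trailingOnes-1s n zero    = refl
trailingOnes-1s n (suc a) = trans (trailingOnes-1s (suc n) a) (+-suc a n)

trailingOnes-01s : ∀ α n a → trailingOnes n (α ++ false ∷ 1s a) ≡ a
trailingOnes-01s []          n a = trans (trailingOnes-1s 0 a) (+-identityʳ a)
trailingOnes-01s (true ∷ α)  n a = trailingOnes-01s α (suc n) a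
trailingOnes-01s (false ∷ α) n a = trailingOnes-01s α 0 a

-- Quantifying over the length of a preceding run of ones makes this stable under prepending bits.
AtMost2TrailingOnes : Pos → Set
AtMost2TrailingOnes p = ∀ n → trailingOnes n p ≤ 2

++-trailing : ∀ α → AtMost2TrailingOnes p → AtMost2TrailingOnes (α ++ p)
++-trailing []          h n = h n
++-trailing (true ∷ α)  h n = ++-trailing α h (suc n)
++-trailing (false ∷ α) h n = ++-trailing α h 0

zeros-one-trailing : ∀ r → AtMost2TrailingOnes (0s (suc r) ++ [ true ])
zeros-one-trailing zero    n = s≤s z≤n
zeros-one-trailing (suc r) n = zeros-one-trailing r 0

block-trailing : ∀ p q → 1 ≤ p + q → AtMost2TrailingOnes (block p q)
block-trailing zero          (suc q) _ =
  ++-trailing {0s (suc q) ++ [ true ]} [ true ] (zeros-one-trailing q)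
block-trailing (suc zero)    zero    _ n = ≤-refl
block-trailing (suc p)       (suc q) _ =
  ++-trailing (0s (suc p)) (++-trailing {0s (suc q) ++ [ true ]} [ true ] (zeros-one-trailing q))
block-trailing (suc (suc p)) zero    _ n = block-trailing (suc p) zero (s≤s z≤n) 0

false∉1s : ∀ a → ¬ (false ∈ 1s a ++ block 0 0)
false∉1s zero    (there (there ()))
false∉1s (suc a) (there f∈) = false∉1s a f∈

-- Only all-ones strings escape a final 01 or 011. As `step` evaluates a string ending in 01ᵃ, this
-- forces `a ≤ 2`.
Eval-trailing : ∀ {v} → Eval p v → false ∈ p → AtMost2TrailingOnes p
Eval-trailing (base₁ zero)                 (there ())
Eval-trailing (base₁ (suc r))              _  = zeros-one-trailing r
Eval-trailing (base₂ a zero zero)          f∈ = ⊥-elim (false∉1s a f∈)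
Eval-trailing (base₂ a zero (suc q))       _  =
  ++-trailing {block 0 (suc q)} (1s a) (block-trailing 0 (suc q) (s≤s z≤n))
Eval-trailing (base₂ a (suc p) q)          _  =
  ++-trailing {block (suc p) q} (1s a) (block-trailing (suc p) q (s≤s z≤n))
Eval-trailing (step α a p q _ _ 1≤p+q _)   _  =
  ++-trailing α (++-trailing {block p q} (false ∷ 1s a) (block-trailing p q 1≤p+q))

Eval-01s : ∀ α {a v} → Eval (α ++ false ∷ 1s a) v → a ≤ 2
Eval-01s α {a} ev = subst (_≤ 2) (trailingOnes-01s α 0 a)
  (Eval-trailing ev (∈-++⁺ʳ α (here refl)) 0)

-- The value returned by the Algorithm

block-pos : ∀ p q → 1 ≤ p + q → 2 * p + q ≡ suc (2 * p + q ∸ 1)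
block-pos zero    (suc q) _ = refl
block-pos (suc p) q       _ = refl

Eval-## : ∀ {v} → Eval p v → ∃[ b ] (Parity b p × v ## val b p)
Eval-## (base₁ r) = let (π , e) = zeros-one r in true , π , subst (negG r ##_) (sym e) (negG-## r)
Eval-## (base₂ a p q) = let (b , π , e) = ones-block a p q in
  b , π , subst (dyadic (a / 2) (2 * p + q) ##_) (sym e) (dyadic-## (a / 2) (2 * p + q))
Eval-## (step α a p q w 1≤a 1≤p+q ev) with Eval-## ev
... | b , π , w## with ++-⟶ α (block-appends a p q _ 1≤a (Eval-01s α ev) (block-pos p q 1≤p+q)) b π
...   | π′ , _ , e = b , π′ , subst (_ ##_) (sym e) (∶-## w## (dyadic-## 0 (2 * p + q ∸ 1)))

#-unique : ∀ X Y → X # s → Y # s → X ≈G Y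
#-unique X Y x y = #-≤ X Y x y ≼-refl , #-≤ Y X y x ≼-refl

Parity-unique : Parity b p → Parity b′ p → b ≡ b′
Parity-unique [] [] = refl
Parity-unique (0∷ π) (0∷ π′) = Parity-unique π π′
Parity-unique (1∷ π) (1∷ π′) = not-injective (Parity-unique π π′)

theorem3p3 : (G : Pos) (v : Game) → IsPosition G → Returns G v → gameOf G ≈G v
theorem3p3 G v _ (G₀ , reduces , _ , eval) =
  let (b , π)       = parity G
      (π₀ , e)      = Reduce*⇒≃ reduces b π
      (b₀ , π′ , v##) = Eval-## eval
      v#            = subst (λ b → v # val b G₀) (Parity-unique π′ π₀) (##⇒# v##)
  -- The fuel in `gameOf G` is `suc (weight G)`, so `≤-refl` gives the bound.
  in #-unique (gameOf G) v (gameFuel-# _ G b π ≤-refl) (subst (v #_) (sym e) v#)
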